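{- Let $n \geq 0$ and $s \geq 1$ be integers, and let $\mathcal F_1, \dots, \mathcal F_s \subset 2^{[n]}$ be cross-dependent. Then \[ \varrho_n(\mathcal F_1) + \dots + \varrho_n(\mathcal F_s) \leq s - 1, \] equivalently $\|\mathcal F_1\|_n + \dots + \|\mathcal F_s\|_n \leq (n+1)(s-1)$.
   Context: $[n]=\{1,\dots,n\}$ and $2^{[n]}$ is its power set. For $\mathcal F \subset 2^{[n]}$ the binomial norm is $\|\mathcal F\|_n = \sum_{F \in \mathcal F} 1\big/\binom{n}{|F|}$, and the relative measure is $\varrho_n(\mathcal F) = \|\mathcal F\|_n/(n+1)$. Families $\mathcal F_1,\dots,\mathcal F_s$ are called cross-dependent if there is no choice of $F_1 \in \mathcal F_1, \dots, F_s \in \mathcal F_s$ such that $F_1,\dots,F_s$ are pairwise disjoint. -}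

module Defs where

open import Data.Nat using (ℕ; zero; suc)
open import Data.Nat.Combinatorics using (_C_)
open import Data.Integer using (+_)
open import Data.Rational using (ℚ; 0ℚ; _+_; _/_)
open import Data.Fin using (Fin)
open import Data.Fin.Subset using (Subset; ∣_∣; _∩_; Empty)
open import Data.List using (List; []; _∷_)
open import Data.List.Membership.Propositional using (_∈_)
open import Data.Product using (∃)
open import Relation.Binary.PropositionalEquality using (_≢_)
open import Relation.Nullary using (¬_)

-- A family F ⊂ 2^[n] is a duplicate-free list of subsets of Fin n
-- (duplicate-freeness is imposed in the statement via `Unique`).

-- 1 / d as a rational; the d = 0 case never occurs for d = n C |F|
-- (since |F| ≤ n), it is only there to make the division total.
inv : ℕ → ℚ
inv zero    = 0ℚ
inv (suc m) = + 1 / suc m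

‖_‖ : ∀ {n} → List (Subset n) → ℚ
‖_‖ {n} []      = 0ℚ
‖_‖ {n} (F ∷ 𝓕) = inv (n C ∣ F ∣) + ‖ 𝓕 ‖

ϱ : ∀ {n} → List (Subset n) → ℚ
ϱ {n} 𝓕 = ‖ 𝓕 ‖ Data.Rational.* (+ 1 / suc n)

ΣFin : ∀ s → (Fin s → ℚ) → ℚ
ΣFin zero    f = 0ℚ
ΣFin (suc s) f = f Fin.zero + ΣFin s (λ i → f (Fin.suc i))

HasDisjointChoice : ∀ {n s} → (Fin s → List (Subset n)) → Set
HasDisjointChoice {n} {s} 𝓕 =
  ∃ λ (F : Fin s → Subset n) →
    ((i : Fin s) → F i ∈ 𝓕 i) ×′
    ((i j : Fin s) → i ≢ j → Empty (F i ∩ F j))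
  where open import Data.Product using () renaming (_×_ to _×′_)

CrossDependent : ∀ {n s} → (Fin s → List (Subset n)) → Set
CrossDependent 𝓕 = ¬ HasDisjointChoice 𝓕

{-# OPTIONS --safe #-}
-- ‖α‖ is the expected number of members of α on a random maximal chain of 2^[n].
-- The heart is that, if γ contains all P ∪ Q with P ∈ α, Q ∈ β disjoint, then
--   ‖α‖ + ‖β‖ ≤ n + 1 + ‖γ‖.
-- Walk up a random chain until it first meets α, in P say, while a chain for β starts at [n]
-- and loses at each step the element that the first chain gains. The missed sets of α and the
-- lost sets of β are paired off, and once P is reached what remains of the chain for β is a
-- random chain of subsets Q of [n] ∖ P, for which P ∪ Q ∈ γ. As an induction on n: if ∅ ∈ α,
-- then β ⊆ γ and ‖α‖ ≤ n + 1; otherwise average over the first element x of the chain.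
-- Iterating bounds Σ ‖𝓕ᵢ‖ by (s - 1)(n + 1) plus the norm of the family of supersets of
-- unions of disjoint choices, which is empty. Norms are scaled by n! to stay in ℕ.
module Submission where

open import Defs
open import Data.Nat using (ℕ; suc)
open import Data.Integer using (+_)
open import Data.Rational using (ℚ; _≤_; _/_)
open import Data.Fin using (Fin)
open import Data.Fin.Subset using (Subset)
open import Data.List using (List)
open import Data.List.Relation.Unary.Unique.Propositional using (Unique)

open import Algebra.Bundles using (CommutativeMonoid)
open import Data.Bool using (Bool; true; false; T; not; _∧_; _∨_; if_then_else_)
open import Data.Bool.Properties using () renaming (_≟_ to _≟ᵇ_)
open import Data.Fin using () renaming (zero to fzero; suc to fsuc)
open import Data.Fin.Subset
  using (inside; outside; _∩_; _∪_; ⊥; ∣_∣; ∁; Empty; _⊆_) renaming (_∈_ to _∈ˢ_)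
open import Data.Fin.Subset.Properties
  using (∪-identityˡ; ∩-zeroˡ; anySubset?; ∣p∣≤n; ∣∁p∣≡n∸∣p∣; ∉⊥; x∈p∩q⁺; x∈p∩q⁻; x∈p∪q⁺)
import Data.Integer as ℤ
import Data.Integer.Properties as ℤₚ
open import Data.List using (foldr) renaming ([] to []ˡ; _∷_ to _∷ˡ_)
open import Data.List.Membership.Propositional using (_∈_)
open import Data.List.Membership.DecPropositional using () renaming (_∈?_ to mem?)
open import Data.List.Relation.Unary.All as All using ()
open import Data.List.Relation.Unary.AllPairs using () renaming (_∷_ to _∷ᵘ_)
open import Data.List.Relation.Unary.Any using (here; there)
import Data.Nat as Nat
open Nat using (zero; _+_; _*_; _∸_; _!; pred; z≤n)
open import Data.Nat.Combinatorics using (_C_; nCk≡n!/k![n-k]!; [n∸k]!k!∣n!)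
open import Data.Nat.Divisibility using (_∣_)
open import Data.Nat.DivMod using (m/n*n≡m)
import Data.Nat.Properties as ℕₚ
open import Data.Product using (∃; _×_; _,_)
import Data.Rational as ℚ
import Data.Rational.Properties as ℚₚ
import Data.Rational.Unnormalised as ℚᵘ
import Data.Rational.Unnormalised.Properties as ℚᵘₚ
open import Data.Sum using (inj₁; inj₂)
open import Data.Vec using ([]; _∷_; insertAt; count; replicate)
open import Data.Vec.Properties using (≡-dec)
open import Function using (_∘_)
open import Relation.Binary using (DecidableEquality)
open import Relation.Binary.PropositionalEquality
open import Relation.Nullary using (yes; no; Dec; does; ¬_; contradiction)
open import Relation.Nullary.Decidable using (⌊_⌋; _×-dec_; T?; toWitness; fromWitness)
open import Algebra.Properties.CommutativeMonoid.Sum ℕₚ.+-0-commutativeMonoid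
  using (sum; sum-cong-≗; ∑-distrib-+)
open import Algebra.Properties.CommutativeSemigroup ℕₚ.+-commutativeSemigroup
  using () renaming (interchange to +-interchange; x∙yz≈y∙xz to x+[y+z]≡y+[x+z])
open import Algebra.Properties.CommutativeSemigroup ℕₚ.*-commutativeSemigroup
  using () renaming (x∙yz≈y∙xz to x*[y*z]≡y*[x*z])
open import Algebra.Properties.CommutativeSemigroup
  (CommutativeMonoid.commutativeSemigroup ℚₚ.*-1-commutativeMonoid)
  using () renaming (interchange to *-interchange)

private
  variable
    n s : ℕ

-- Boolean values make membership decidable and let a family enter sums as a 0/1 coefficient.
Family : ℕ → Set
Family n = Subset n → Bool

-- Sums over all subsets of [n] and over its elements.

total : (Subset n → ℕ) → ℕ
total {zero}  f = f []
total {suc n} f = total (λ P → f (outside ∷ P)) + total (λ P → f (inside ∷ P))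

total-cong : {f g : Subset n → ℕ} → (∀ P → f P ≡ g P) → total f ≡ total g
total-cong {zero}  f≗g = f≗g []
total-cong {suc n} f≗g =
  cong₂ _+_ (total-cong (f≗g ∘ (outside ∷_))) (total-cong (f≗g ∘ (inside ∷_)))

total-mono : {f g : Subset n → ℕ} → (∀ P → f P Nat.≤ g P) → total f Nat.≤ total g
total-mono {zero}  f≤g = f≤g []
total-mono {suc n} f≤g =
  ℕₚ.+-mono-≤ (total-mono (f≤g ∘ (outside ∷_))) (total-mono (f≤g ∘ (inside ∷_)))

total-+ : (f g : Subset n → ℕ) → total (λ P → f P + g P) ≡ total f + total g
total-+ {zero}  f g = refl
total-+ {suc n} f g = trans
  (cong₂ _+_ (total-+ (f ∘ (outside ∷_)) (g ∘ (outside ∷_)))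
             (total-+ (f ∘ (inside ∷_)) (g ∘ (inside ∷_))))
  (+-interchange (total (f ∘ (outside ∷_))) _ _ _)

total-0 : ∀ n → total {n} (λ _ → 0) ≡ 0
total-0 zero    = refl
total-0 (suc n) = cong₂ _+_ (total-0 n) (total-0 n)

sum-mono : {f g : Fin n → ℕ} → (∀ x → f x Nat.≤ g x) → sum f Nat.≤ sum g
sum-mono {zero}  f≤g = z≤n
sum-mono {suc n} f≤g = ℕₚ.+-mono-≤ (f≤g fzero) (sum-mono (f≤g ∘ fsuc))

sum-const : ∀ n k → sum {n} (λ _ → k) ≡ n * k
sum-const zero    k = refl
sum-const (suc n) k = cong (k Nat.+_) (sum-const n k)

-- Counting members and non-members alike, so that upward and downward chains share one argument.

# : Bool → Subset n → ℕ
# b = count (_≟ᵇ b)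

#-replicate-not : ∀ b n → # b (replicate n (not b)) ≡ 0
#-replicate-not inside  zero    = refl
#-replicate-not inside  (suc n) = #-replicate-not inside n
#-replicate-not outside zero    = refl
#-replicate-not outside (suc n) = #-replicate-not outside n

#-replicate : ∀ b n → # b (replicate n b) ≡ n
#-replicate inside  zero    = refl
#-replicate inside  (suc n) = cong suc (#-replicate inside n)
#-replicate outside zero    = refl
#-replicate outside (suc n) = cong suc (#-replicate outside n)

#≡0⇒replicate : ∀ b (P : Subset n) → # b P ≡ 0 → P ≡ replicate n (not b)
#≡0⇒replicate b       []            eq = refl
#≡0⇒replicate inside  (outside ∷ P) eq = cong (outside ∷_) (#≡0⇒replicate inside P eq)
#≡0⇒replicate outside (inside ∷ P)  eq = cong (inside ∷_) (#≡0⇒replicate outside P eq)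

#-insertAt : ∀ b (P : Subset n) x → # b (insertAt P x b) ≡ suc (# b P)
#-insertAt inside  P             fzero    = refl
#-insertAt outside P             fzero    = refl
#-insertAt inside  (inside ∷ P)  (fsuc x) = cong suc (#-insertAt inside P x)
#-insertAt inside  (outside ∷ P) (fsuc x) = #-insertAt inside P x
#-insertAt outside (inside ∷ P)  (fsuc x) = #-insertAt outside P x
#-insertAt outside (outside ∷ P) (fsuc x) = cong suc (#-insertAt outside P x)

#-insertAt-not : ∀ b (P : Subset n) x → # (not b) (insertAt P x b) ≡ # (not b) P
#-insertAt-not inside  P             fzero    = refl
#-insertAt-not outside P             fzero    = refl
#-insertAt-not inside  (inside ∷ P)  (fsuc x) = #-insertAt-not inside P x
#-insertAt-not inside  (outside ∷ P) (fsuc x) = cong suc (#-insertAt-not inside P x)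
#-insertAt-not outside (inside ∷ P)  (fsuc x) = cong suc (#-insertAt-not outside P x)
#-insertAt-not outside (outside ∷ P) (fsuc x) = #-insertAt-not outside P x

-- Double counting of the pairs (P , x) with P x ≡ b.
total-insertAt : ∀ b (ψ : Subset (suc n) → ℕ) →
  sum (λ x → total (λ P → ψ (insertAt P x b))) ≡ total (λ P → # b P * ψ P)
total-insertAt {zero}  inside  ψ = refl
total-insertAt {zero}  outside ψ = sym (ℕₚ.+-identityʳ _)
total-insertAt {suc n} b ψ = trans (cong (total (λ P → ψ (b ∷ P)) Nat.+_) tails) (heads b)
  where
  count∷ : Bool → Bool → ℕ
  count∷ b c = total (λ P → # b P * ψ (c ∷ P))

  tails : sum (λ x → total (λ P → ψ (insertAt P (fsuc x) b)))
          ≡ count∷ b outside + count∷ b inside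
  tails = trans
    (∑-distrib-+ (λ x → total (λ P → ψ (outside ∷ insertAt P x b)))
                 (λ x → total (λ P → ψ (inside ∷ insertAt P x b))))
    (cong₂ _+_ (total-insertAt b (ψ ∘ (outside ∷_))) (total-insertAt b (ψ ∘ (inside ∷_))))

  -- Since `# b (b ∷ P)` is one more than `# b P`, the term for x = `fzero` is absorbed by the half
  -- of `total` with head `b`; the other half is unchanged.
  heads : ∀ b → total (λ P → ψ (b ∷ P)) + (count∷ b outside + count∷ b inside)
          ≡ total (λ P → # b P * ψ P)
  heads inside  = trans
    (x+[y+z]≡y+[x+z] (total (λ P → ψ (inside ∷ P))) (count∷ inside outside) (count∷ inside inside))
    (cong (count∷ inside outside Nat.+_)
      (sym (total-+ (λ P → ψ (inside ∷ P)) (λ P → # inside P * ψ (inside ∷ P)))))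
  heads outside = trans
    (sym (ℕₚ.+-assoc (total (λ P → ψ (outside ∷ P))) (count∷ outside outside) (count∷ outside inside)))
    (cong (_+ count∷ outside inside)
      (sym (total-+ (λ P → ψ (outside ∷ P)) (λ P → # outside P * ψ (outside ∷ P)))))

-- Indicators, chain counts and the scaled norm.

𝟙 : Bool → ℕ
𝟙 b = if b then 1 else 0

_≟ˢ_ : DecidableEquality (Subset n)
_≟ˢ_ = ≡-dec _≟ᵇ_

δ : Subset n → Subset n → ℕ
δ P Q = 𝟙 (does (P ≟ˢ Q))

total-δ : (P : Subset n) (f : Subset n → ℕ) → total (λ Q → δ P Q * f Q) ≡ f P
total-δ []            f = ℕₚ.+-identityʳ _
total-δ {suc n} (inside ∷ P)  f = cong₂ _+_ (total-0 n) (total-δ P (f ∘ (inside ∷_)))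
total-δ {suc n} (outside ∷ P) f =
  trans (cong₂ _+_ (total-δ P (f ∘ (outside ∷_))) (total-0 n)) (ℕₚ.+-identityʳ _)

-- The number of maximal chains of 2^[n] through `P`, that is, n! divided by the binomial
-- coefficient of `P`.
weight : Subset n → ℕ
weight P = # inside P ! * # outside P !

weight-split : ∀ b (P : Subset n) → weight P ≡ # b P ! * # (not b) P !
weight-split inside  P = refl
weight-split outside P = ℕₚ.*-comm (# inside P !) _

weight-replicate : ∀ b n → weight (replicate n (not b)) ≡ n !
weight-replicate b n = begin
  weight (replicate n (not b))                                     ≡⟨ weight-split b (replicate n (not b)) ⟩
  # b (replicate n (not b)) ! * # (not b) (replicate n (not b)) !  ≡⟨ cong₂ (λ i j → i ! * j !) (#-replicate-not b n) (#-replicate (not b) n) ⟩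
  1 * n !                                                          ≡⟨ ℕₚ.*-identityˡ (n !) ⟩
  n !                                                              ∎
  where open ≡-Reasoning

-- n! times the binomial norm.
mass : Family n → ℕ
mass α = total (λ P → 𝟙 (α P) * weight P)

-- The link of the family at `x` when `b` is `inside`, the deletion of `x` when `b` is `outside`:
-- what a chain still sees of the family after its first step `x`.
section : Bool → Fin (suc n) → Family (suc n) → Family n
section b x α P = α (insertAt P x b)

-- Conditioning a random maximal chain, read upwards (b = inside) or downwards (b = outside),
-- on its first step x.
mass-sections : ∀ b (α : Family (suc n)) →
  mass α ≡ 𝟙 (α (replicate (suc n) (not b))) * suc n ! + sum (λ x → mass (section b x α))
mass-sections {n} b α = begin
  mass α
    ≡⟨ total-cong pointwise ⟩
  total (λ P → δ P₀ P * (𝟙 (α P) * weight P) + # b P * ψ P)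
    ≡⟨ total-+ (λ P → δ P₀ P * (𝟙 (α P) * weight P)) (λ P → # b P * ψ P) ⟩
  total (λ P → δ P₀ P * (𝟙 (α P) * weight P)) + total (λ P → # b P * ψ P)
    ≡⟨ cong₂ _+_ (total-δ P₀ (λ P → 𝟙 (α P) * weight P)) (sym (total-insertAt b ψ)) ⟩
  𝟙 (α P₀) * weight P₀ + sum (λ x → total (λ P → ψ (insertAt P x b)))
    ≡⟨ cong₂ (λ k l → 𝟙 (α P₀) * k + l) (weight-replicate b (suc n)) (sum-cong-≗ (λ x → total-cong (ψ-insertAt x))) ⟩
  𝟙 (α P₀) * suc n ! + sum (λ x → mass (section b x α)) ∎
  where
  open ≡-Reasoning
  -- The start of the chain: the empty set when `b` is `inside`, all of [n + 1] when `b` is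
  -- `outside`.
  P₀ = replicate (suc n) (not b)

  -- The term of `P` after one coordinate equal to `b` is removed. The value `pred 0` arises only at
  -- `P₀`, where the factor `# b P` cancels it.
  ψ : Subset (suc n) → ℕ
  ψ P = 𝟙 (α P) * (pred (# b P) ! * # (not b) P !)

  ψ-insertAt : ∀ x P → ψ (insertAt P x b) ≡ 𝟙 (section b x α P) * weight P
  ψ-insertAt x P = cong (𝟙 (section b x α P) *_) (trans
    (cong₂ (λ i j → pred i ! * j !) (#-insertAt b P x) (#-insertAt-not b P x))
    (sym (weight-split b P)))

  weight≡ : ∀ P {k} → # b P ≡ suc k → weight P ≡ # b P * (pred (# b P) ! * # (not b) P !)
  weight≡ P {k} eq = begin
    weight P                                  ≡⟨ weight-split b P ⟩
    # b P ! * # (not b) P !                   ≡⟨ cong (λ i → i ! * # (not b) P !) eq ⟩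
    suc k * k ! * # (not b) P !               ≡⟨ ℕₚ.*-assoc (suc k) (k !) _ ⟩
    suc k * (k ! * # (not b) P !)             ≡⟨ cong (λ i → i * (pred i ! * # (not b) P !)) eq ⟨
    # b P * (pred (# b P) ! * # (not b) P !)  ∎

  -- Only `P₀` has `# b P` equal to 0; every other set spreads its weight evenly over the `# b P`
  -- first steps that lead towards it.
  pointwise : ∀ P → 𝟙 (α P) * weight P ≡ δ P₀ P * (𝟙 (α P) * weight P) + # b P * ψ P
  pointwise P with P₀ ≟ˢ P
  ... | yes refl = sym (begin
    1 * (𝟙 (α P₀) * weight P₀) + # b P₀ * ψ P₀  ≡⟨ cong (λ i → 1 * (𝟙 (α P₀) * weight P₀) + i * ψ P₀) (#-replicate-not b (suc n)) ⟩
    1 * (𝟙 (α P₀) * weight P₀) + 0              ≡⟨ ℕₚ.+-identityʳ _ ⟩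
    1 * (𝟙 (α P₀) * weight P₀)                  ≡⟨ ℕₚ.*-identityˡ _ ⟩
    𝟙 (α P₀) * weight P₀                        ∎)
  ... | no P₀≢P with # b P in eq
  ...   | zero  = contradiction (sym (#≡0⇒replicate b P eq)) P₀≢P
  ...   | suc k = begin
    𝟙 (α P) * weight P                             ≡⟨ cong (𝟙 (α P) *_) (trans (weight≡ P eq) (cong (λ i → i * (pred i ! * # (not b) P !)) eq)) ⟩
    𝟙 (α P) * (suc k * (k ! * # (not b) P !))      ≡⟨ x*[y*z]≡y*[x*z] (𝟙 (α P)) (suc k) _ ⟩
    suc k * (𝟙 (α P) * (k ! * # (not b) P !))      ∎

-- Every maximal chain has n + 1 members, so the norm of the full power set is n + 1. The recursion
-- splits off the first member of the chain.
mass-const-true : ∀ n → mass {n} (λ _ → true) ≡ suc n !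
mass-const-true zero    = refl
mass-const-true (suc n) = begin
  mass {suc n} (λ _ → true)                                  ≡⟨ mass-sections {n} inside (λ _ → true) ⟩
  1 * suc n ! + sum {suc n} (λ _ → mass {n} (λ _ → true))    ≡⟨ cong₂ _+_ (ℕₚ.*-identityˡ (suc n !)) (sum-const (suc n) _) ⟩
  suc n ! + suc n * mass {n} (λ _ → true)                    ≡⟨ cong (λ m → suc n ! + suc n * m) (mass-const-true n) ⟩
  suc n ! + suc n * suc n !                                  ∎
  where open ≡-Reasoning

𝟙≤1 : ∀ b → 𝟙 b Nat.≤ 1
𝟙≤1 true  = ℕₚ.≤-refl
𝟙≤1 false = z≤n

𝟙-mono : ∀ {a b} → (T a → T b) → 𝟙 a Nat.≤ 𝟙 b
𝟙-mono {false}         a⇒b = z≤n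
𝟙-mono {true}  {true}  a⇒b = ℕₚ.≤-refl
𝟙-mono {true}  {false} a⇒b = contradiction (a⇒b _) (λ ())

mass-mono : {α β : Family n} → (∀ P → T (α P) → T (β P)) → mass α Nat.≤ mass β
mass-mono α⊆β = total-mono λ P → ℕₚ.*-monoˡ-≤ (weight P) (𝟙-mono (α⊆β P))

mass≤ : (α : Family n) → mass α Nat.≤ suc n !
mass≤ {n} α = ℕₚ.≤-trans (mass-mono {α = α} (λ _ _ → _)) (ℕₚ.≤-reflexive (mass-const-true n))

mass-empty : {α : Family n} → (∀ P → ¬ T (α P)) → mass α ≡ 0
mass-empty {n} {α} ¬α = ℕₚ.n≤0⇒n≡0 (ℕₚ.≤-trans
  (mass-mono {α = α} {β = λ _ → false} ¬α) (ℕₚ.≤-reflexive (total-0 n)))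

-- Set operations under insertion of an element, and the inequality for disjoint unions.

insertAt-∩ : ∀ (P Q : Subset n) x {a b} → insertAt P x a ∩ insertAt Q x b ≡ insertAt (P ∩ Q) x (a ∧ b)
insertAt-∩ P       Q       fzero    = refl
insertAt-∩ (p ∷ P) (q ∷ Q) (fsuc x) = cong (_ ∷_) (insertAt-∩ P Q x)

insertAt-∪ : ∀ (P Q : Subset n) x {a b} → insertAt P x a ∪ insertAt Q x b ≡ insertAt (P ∪ Q) x (a ∨ b)
insertAt-∪ P       Q       fzero    = refl
insertAt-∪ (p ∷ P) (q ∷ Q) (fsuc x) = cong (_ ∷_) (insertAt-∪ P Q x)

insertAt-⊥ : ∀ (x : Fin (suc n)) → insertAt ⊥ x outside ≡ ⊥
insertAt-⊥             fzero    = refl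
insertAt-⊥ {n = suc n} (fsuc x) = cong (outside ∷_) (insertAt-⊥ x)

mass-disjoint-unions : (α β γ : Family n) →
  (∀ P Q → T (α P) → T (β Q) → P ∩ Q ≡ ⊥ → T (γ (P ∪ Q))) →
  mass α + mass β Nat.≤ suc n ! + mass γ
mass-disjoint-unions {n} α β γ unions with α ⊥ in α⊥
... | true  = ℕₚ.+-mono-≤ (mass≤ α) (mass-mono λ Q βQ →
  subst (T ∘ γ) (∪-identityˡ Q) (unions ⊥ Q (subst T (sym α⊥) _) βQ (∩-zeroˡ Q)))
-- For n = 0 the empty set is the only subset, so `α` has no members and `mass β` is at most 1.
mass-disjoint-unions {zero} α β γ unions | false rewrite α⊥ =
  ℕₚ.≤-trans (mass≤ β) (ℕₚ.m≤m+n 1 (mass γ))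
mass-disjoint-unions {suc n} α β γ unions | false = begin
  mass α + mass β
    ≡⟨ cong₂ _+_ (mass-sections inside α) (mass-sections outside β) ⟩
  (𝟙 (α ⊥) * N + Σα) + (𝟙 (β (replicate _ inside)) * N + Σβ)
    -- Here only the chain for `β` can have a member at its start. Its single `N` and the `suc n`
    -- copies from the induction hypothesis later make up `suc (suc n) !`.
    ≤⟨ ℕₚ.+-mono-≤ (ℕₚ.≤-reflexive (cong (λ a → 𝟙 a * N + Σα) α⊥))
                   (ℕₚ.+-monoˡ-≤ Σβ (ℕₚ.*-monoˡ-≤ N (𝟙≤1 (β (replicate _ inside))))) ⟩
  Σα + (1 * N + Σβ)
    ≡⟨ cong (λ m → Σα + (m + Σβ)) (ℕₚ.*-identityˡ N) ⟩
  Σα + (N + Σβ)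
    ≡⟨ x+[y+z]≡y+[x+z] Σα N Σβ ⟩
  N + (Σα + Σβ)
    ≡⟨ cong (N Nat.+_) (∑-distrib-+ (λ x → mass (section inside x α)) (λ x → mass (section outside x β))) ⟨
  N + sum (λ x → mass (section inside x α) + mass (section outside x β))
    ≤⟨ ℕₚ.+-monoʳ-≤ N (sum-mono λ x → mass-disjoint-unions
         (section inside x α) (section outside x β) (section inside x γ) (unions-section x)) ⟩
  N + sum (λ x → N + mass (section inside x γ))
    ≡⟨ cong (N Nat.+_) (∑-distrib-+ {suc n} (λ _ → N) (λ x → mass (section inside x γ))) ⟩
  N + (sum {suc n} (λ _ → N) + Σγ)
    ≡⟨ cong (λ m → N + (m + Σγ)) (sum-const (suc n) N) ⟩
  N + (suc n * N + Σγ)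
    ≡⟨ ℕₚ.+-assoc N (suc n * N) Σγ ⟨
  suc (suc n) ! + Σγ
    -- The links of `γ` account for all of `mass γ` except the empty set, whose contribution is
    -- nonnegative.
    ≤⟨ ℕₚ.+-monoʳ-≤ (suc (suc n) !) (ℕₚ.m≤n+m Σγ (𝟙 (γ ⊥) * N)) ⟩
  suc (suc n) ! + (𝟙 (γ ⊥) * N + Σγ)
    ≡⟨ cong (suc (suc n) ! Nat.+_) (mass-sections inside γ) ⟨
  suc (suc n) ! + mass γ ∎
  where
  open ℕₚ.≤-Reasoning
  N  = suc n !
  Σα = sum (λ x → mass (section inside x α))
  Σβ = sum (λ x → mass (section outside x β))
  Σγ = sum (λ x → mass (section inside x γ))

  -- Putting `x` into `P` and leaving it out of `Q` keeps the two disjoint and puts `x` into the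
  -- union. Hence links for `α` and `γ`, but deletions for `β`.
  unions-section : ∀ x P Q → T (section inside x α P) → T (section outside x β Q) →
    P ∩ Q ≡ ⊥ → T (section inside x γ (P ∪ Q))
  unions-section x P Q αP βQ P∩Q≡⊥ = subst (T ∘ γ) (insertAt-∪ P Q x)
    (unions _ _ αP βQ (trans (insertAt-∩ P Q x)
      (trans (cong (λ R → insertAt R x outside) P∩Q≡⊥) (insertAt-⊥ x))))

-- Families of disjoint unions, and iteration over all the given families.

IsDisjointUnion? : (α β : Family n) (R : Subset n) →
  Dec (∃ λ P → ∃ λ Q → (T (α P) × T (β Q)) × P ∩ Q ≡ ⊥ × P ∪ Q ≡ R)
IsDisjointUnion? α β R = anySubset? λ P → anySubset? λ Q →
  (T? (α P) ×-dec T? (β Q)) ×-dec ((P ∩ Q) ≟ˢ ⊥) ×-dec ((P ∪ Q) ≟ˢ R)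

infixr 6 _⊎_
-- The smallest `γ` that satisfies the hypothesis of `mass-disjoint-unions`.
_⊎_ : Family n → Family n → Family n
(α ⊎ β) R = ⌊ IsDisjointUnion? α β R ⌋

-- The empty union counts as everything, so that ⨄ 𝓕 is the family of all supersets
-- of unions of disjoint choices.
⨄ : (Fin s → Family n) → Family n
⨄ {zero}  𝓕 R = true
⨄ {suc s} 𝓕   = 𝓕 fzero ⊎ ⨄ (𝓕 ∘ fsuc)

-- Each family joined to the union costs one `suc n !`. The extra `suc n !` on the left is the mass
-- of the empty `⨄`, which makes the base case an equality.
mass-⨄ : (𝓕 : Fin s → Family n) →
  sum (mass ∘ 𝓕) + suc n ! Nat.≤ s * suc n ! + mass (⨄ 𝓕)
mass-⨄ {zero}  {n} 𝓕 = ℕₚ.≤-reflexive (sym (mass-const-true n))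
mass-⨄ {suc s} {n} 𝓕 = begin
  (mass (𝓕 fzero) + sum (mass ∘ 𝓕 ∘ fsuc)) + N  ≡⟨ ℕₚ.+-assoc (mass (𝓕 fzero)) _ N ⟩
  mass (𝓕 fzero) + (sum (mass ∘ 𝓕 ∘ fsuc) + N)  ≤⟨ ℕₚ.+-monoʳ-≤ (mass (𝓕 fzero)) (mass-⨄ (𝓕 ∘ fsuc)) ⟩
  mass (𝓕 fzero) + (s * N + mass (⨄ (𝓕 ∘ fsuc))) ≡⟨ x+[y+z]≡y+[x+z] (mass (𝓕 fzero)) (s * N) _ ⟩
  s * N + (mass (𝓕 fzero) + mass (⨄ (𝓕 ∘ fsuc))) ≤⟨ ℕₚ.+-monoʳ-≤ (s * N) (mass-disjoint-unions (𝓕 fzero) _ (⨄ 𝓕) unions) ⟩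
  s * N + (N + mass (⨄ 𝓕))                       ≡⟨ x+[y+z]≡y+[x+z] (s * N) N _ ⟩
  N + (s * N + mass (⨄ 𝓕))                       ≡⟨ ℕₚ.+-assoc N (s * N) _ ⟨
  suc s * N + mass (⨄ 𝓕)                         ∎
  where
  open ℕₚ.≤-Reasoning
  N = suc n !
  unions : ∀ P Q → T (𝓕 fzero P) → T (⨄ (𝓕 ∘ fsuc) Q) → P ∩ Q ≡ ⊥ → T (⨄ 𝓕 (P ∪ Q))
  unions P Q αP βQ disj =
    fromWitness {a? = IsDisjointUnion? (𝓕 fzero) (⨄ (𝓕 ∘ fsuc)) (P ∪ Q)} (P , Q , (αP , βQ) , disj , refl)

-- The clause `F i ⊆ R` strengthens the induction: the first set is known to be disjoint only from
-- the union `Q` of the rest, and the inclusion passes this on to each later set.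
⨄-sound : (𝓕 : Fin s → Family n) (R : Subset n) → T (⨄ 𝓕 R) →
  ∃ λ (F : Fin s → Subset n) →
    (∀ i → T (𝓕 i (F i))) × (∀ i j → i ≢ j → Empty (F i ∩ F j)) × (∀ i → F i ⊆ R)
⨄-sound {zero}  𝓕 R _ = (λ ()) , (λ ()) , (λ ()) , (λ ())
⨄-sound {suc s} {n} 𝓕 R R∈
  with P , Q , (P∈ , Q∈) , P∩Q≡⊥ , refl ← toWitness {a? = IsDisjointUnion? (𝓕 fzero) (⨄ (𝓕 ∘ fsuc)) R} R∈
  with G , G∈ , G-disj , G⊆Q ← ⨄-sound (𝓕 ∘ fsuc) Q Q∈
  = F , F∈ , F-disj , F⊆R
  where
  F : Fin (suc s) → Subset n
  F fzero    = P
  F (fsuc i) = G i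

  F∈ : ∀ i → T (𝓕 i (F i))
  F∈ fzero    = P∈
  F∈ (fsuc i) = G∈ i

  P∩Q-empty : ∀ {x} → x ∈ˢ P → ¬ x ∈ˢ Q
  P∩Q-empty x∈P x∈Q = ∉⊥ (subst (_ ∈ˢ_) P∩Q≡⊥ (x∈p∩q⁺ (x∈P , x∈Q)))

  F-disj : ∀ i j → i ≢ j → Empty (F i ∩ F j)
  F-disj fzero    fzero    i≢j _ = i≢j refl
  F-disj fzero    (fsuc j) _ (x , x∈) with x∈P , x∈G ← x∈p∩q⁻ P (G j) x∈ = P∩Q-empty x∈P (G⊆Q j x∈G)
  F-disj (fsuc i) fzero    _ (x , x∈) with x∈G , x∈P ← x∈p∩q⁻ (G i) P x∈ = P∩Q-empty x∈P (G⊆Q i x∈G)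
  F-disj (fsuc i) (fsuc j) i≢j = G-disj i j (i≢j ∘ cong fsuc)

  F⊆R : ∀ i → F i ⊆ P ∪ Q
  F⊆R fzero    = x∈p∪q⁺ ∘ inj₁
  F⊆R (fsuc i) = x∈p∪q⁺ ∘ inj₂ ∘ G⊆Q i

-- From duplicate-free lists to Boolean families.

_∈ˢ?_ : (P : Subset n) (𝓕 : List (Subset n)) → Dec (P ∈ 𝓕)
_∈ˢ?_ = mem? _≟ˢ_

members : List (Subset n) → Family n
members 𝓕 P = ⌊ P ∈ˢ? 𝓕 ⌋

listWeight : List (Subset n) → ℕ
listWeight = foldr (λ P w → weight P + w) 0

-- Distinct entries are distinct sets, so no term of `mass` is used twice. The inequality goes in
-- the direction that an upper bound for the lists requires.
listWeight≤mass : (𝓕 : List (Subset n)) → Unique 𝓕 → listWeight 𝓕 Nat.≤ mass (members 𝓕)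
listWeight≤mass []ˡ       _            = z≤n
listWeight≤mass (F ∷ˡ 𝓕) (F∉𝓕 ∷ᵘ 𝓕!) = begin
  weight F + listWeight 𝓕
    ≤⟨ ℕₚ.+-monoʳ-≤ (weight F) (listWeight≤mass 𝓕 𝓕!) ⟩
  weight F + mass (members 𝓕)
    ≡⟨ cong (_+ mass (members 𝓕)) (total-δ F weight) ⟨
  total (λ P → δ F P * weight P) + mass (members 𝓕)
    ≡⟨ total-+ (λ P → δ F P * weight P) _ ⟨
  total (λ P → δ F P * weight P + 𝟙 (members 𝓕 P) * weight P)
    ≤⟨ total-mono (λ P → ℕₚ.≤-trans
         (ℕₚ.≤-reflexive (sym (ℕₚ.*-distribʳ-+ (weight P) (δ F P) _)))
         (ℕₚ.*-monoˡ-≤ (weight P) (𝟙-∷ (F ≟ˢ P) (P ∈ˢ? 𝓕) (P ∈ˢ? (F ∷ˡ 𝓕))))) ⟩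
  mass (members (F ∷ˡ 𝓕)) ∎
  where
  open ℕₚ.≤-Reasoning
  -- The two indicators on the left are never both 1, because `F` does not occur in `𝓕`.
  𝟙-∷ : ∀ {P} (F≡P? : Dec (F ≡ P)) (P∈𝓕? : Dec (P ∈ 𝓕)) (P∈? : Dec (P ∈ F ∷ˡ 𝓕)) →
    𝟙 (does F≡P?) + 𝟙 ⌊ P∈𝓕? ⌋ Nat.≤ 𝟙 ⌊ P∈? ⌋
  𝟙-∷ (yes refl) (yes F∈𝓕) _        = contradiction refl (All.lookup F∉𝓕 F∈𝓕)
  𝟙-∷ (yes refl) (no _)    (yes _)  = ℕₚ.≤-refl
  𝟙-∷ (yes refl) (no _)    (no F∉)  = contradiction (here refl) F∉
  𝟙-∷ (no _)     (yes P∈𝓕) (no P∉)  = contradiction (there P∈𝓕) P∉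
  𝟙-∷ (no _)     (yes _)   (yes _)  = ℕₚ.≤-refl
  𝟙-∷ (no _)     (no _)    _        = z≤n

-- Cross-dependence makes `⨄` empty, so `mass-⨄` bounds the sum plus one `suc n !` by `suc s` copies
-- of `suc n !`. Cancelling one copy leaves `s`, one less than the number of families.
sum-listWeight≤ : (𝓕 : Fin (suc s) → List (Subset n)) → (∀ i → Unique (𝓕 i)) →
  CrossDependent 𝓕 → sum (listWeight ∘ 𝓕) Nat.≤ s * suc n !
sum-listWeight≤ {s} {n} 𝓕 𝓕! cross = ℕₚ.+-cancelˡ-≤ N _ _ (begin
  N + sum (listWeight ∘ 𝓕)        ≡⟨ ℕₚ.+-comm N _ ⟩
  sum (listWeight ∘ 𝓕) + N        ≤⟨ ℕₚ.+-monoˡ-≤ N (sum-mono λ i → listWeight≤mass (𝓕 i) (𝓕! i)) ⟩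
  sum (mass ∘ members ∘ 𝓕) + N    ≤⟨ mass-⨄ (members ∘ 𝓕) ⟩
  suc s * N + mass (⨄ (members ∘ 𝓕)) ≡⟨ cong (suc s * N Nat.+_) (mass-empty {α = ⨄ (members ∘ 𝓕)} noChoice) ⟩
  suc s * N + 0                   ≡⟨ ℕₚ.+-identityʳ _ ⟩
  N + s * N                       ∎)
  where
  open ℕₚ.≤-Reasoning
  N = suc n !
  noChoice : ∀ R → ¬ T (⨄ (members ∘ 𝓕) R)
  noChoice R R∈ with F , F∈ , F-disj , _ ← ⨄-sound (members ∘ 𝓕) R R∈ =
    cross (F , (λ i → toWitness {a? = F i ∈ˢ? 𝓕 i} (F∈ i)) , F-disj)

-- Chain counts and binomial coefficients.

#outside≡∣∁∣ : (P : Subset n) → # outside P ≡ ∣ ∁ P ∣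
#outside≡∣∁∣ []            = refl
#outside≡∣∁∣ (inside ∷ P)  = #outside≡∣∁∣ P
#outside≡∣∁∣ (outside ∷ P) = cong suc (#outside≡∣∁∣ P)

nC∣P∣*weight : (P : Subset n) → (n C ∣ P ∣) * weight P ≡ n !
nC∣P∣*weight {n} P = begin
  -- `# inside P` is `∣ P ∣` by definition, so only the count of non-members has to be rewritten.
  (n C k) * weight P                                 ≡⟨ cong (λ j → (n C k) * (k ! * j !)) (trans (#outside≡∣∁∣ P) (∣∁p∣≡n∸∣p∣ P)) ⟩
  (n C k) * (k ! * (n ∸ k) !)                          ≡⟨ cong (_* (k ! * (n ∸ k) !)) (nCk≡n!/k![n-k]! k≤n) ⟩
  (n ! Nat./ (k ! * (n ∸ k) !)) * (k ! * (n ∸ k) !)  ≡⟨ m/n*n≡m (subst (_∣ n !) (ℕₚ.*-comm ((n ∸ k) !) (k !)) ([n∸k]!k!∣n! k≤n)) ⟩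
  n !                                                ∎
  where
  open ≡-Reasoning
  k = ∣ P ∣
  k≤n = ∣p∣≤n P
  instance _ = k ℕₚ.!* (n ∸ k) !≢0

-- The embedding of ℕ into ℚ, by way of unnormalised fractions.

fromℚᵘ-homo-+ : ∀ p q → ℚ.fromℚᵘ (p ℚᵘ.+ q) ≡ ℚ.fromℚᵘ p ℚ.+ ℚ.fromℚᵘ q
fromℚᵘ-homo-+ p q = ℚₚ.toℚᵘ-injective (begin
  ℚ.toℚᵘ (ℚ.fromℚᵘ (p ℚᵘ.+ q))                     ≈⟨ ℚₚ.toℚᵘ-fromℚᵘ (p ℚᵘ.+ q) ⟩
  p ℚᵘ.+ q                                         ≈⟨ ℚᵘₚ.+-cong (ℚₚ.toℚᵘ-fromℚᵘ p) (ℚₚ.toℚᵘ-fromℚᵘ q) ⟨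
  ℚ.toℚᵘ (ℚ.fromℚᵘ p) ℚᵘ.+ ℚ.toℚᵘ (ℚ.fromℚᵘ q)     ≈⟨ ℚₚ.toℚᵘ-homo-+ (ℚ.fromℚᵘ p) (ℚ.fromℚᵘ q) ⟨
  ℚ.toℚᵘ (ℚ.fromℚᵘ p ℚ.+ ℚ.fromℚᵘ q)               ∎)
  where open import Relation.Binary.Reasoning.Setoid ℚᵘₚ.≃-setoid

fromℚᵘ-homo-* : ∀ p q → ℚ.fromℚᵘ (p ℚᵘ.* q) ≡ ℚ.fromℚᵘ p ℚ.* ℚ.fromℚᵘ q
fromℚᵘ-homo-* p q = ℚₚ.toℚᵘ-injective (begin
  ℚ.toℚᵘ (ℚ.fromℚᵘ (p ℚᵘ.* q))                     ≈⟨ ℚₚ.toℚᵘ-fromℚᵘ (p ℚᵘ.* q) ⟩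
  p ℚᵘ.* q                                         ≈⟨ ℚᵘₚ.*-cong (ℚₚ.toℚᵘ-fromℚᵘ p) (ℚₚ.toℚᵘ-fromℚᵘ q) ⟨
  ℚ.toℚᵘ (ℚ.fromℚᵘ p) ℚᵘ.* ℚ.toℚᵘ (ℚ.fromℚᵘ q)     ≈⟨ ℚₚ.toℚᵘ-homo-* (ℚ.fromℚᵘ p) (ℚ.fromℚᵘ q) ⟨
  ℚ.toℚᵘ (ℚ.fromℚᵘ p ℚ.* ℚ.fromℚᵘ q)               ∎)
  where open import Relation.Binary.Reasoning.Setoid ℚᵘₚ.≃-setoid

fromℕ : ℕ → ℚ
fromℕ m = + m / 1

fromℕ-+ : ∀ m k → fromℕ (m + k) ≡ fromℕ m ℚ.+ fromℕ k
fromℕ-+ m k = trans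
  -- Unnormalised addition multiplies each numerator by the other denominator, here 1; these factors
  -- are inserted first.
  (cong₂ (λ i j → (i ℤ.+ j) / 1) (sym (ℤₚ.*-identityʳ (+ m))) (sym (ℤₚ.*-identityʳ (+ k))))
  (fromℚᵘ-homo-+ (ℚᵘ.mkℚᵘ (+ m) 0) (ℚᵘ.mkℚᵘ (+ k) 0))

fromℕ-* : ∀ m k → fromℕ (m * k) ≡ fromℕ m ℚ.* fromℕ k
fromℕ-* m k = trans (cong (_/ 1) (ℤₚ.pos-* m k))
  (fromℚᵘ-homo-* (ℚᵘ.mkℚᵘ (+ m) 0) (ℚᵘ.mkℚᵘ (+ k) 0))

fromℕ-mono-≤ : ∀ {m k} → m Nat.≤ k → fromℕ m ≤ fromℕ k
fromℕ-mono-≤ {m} {k} m≤k = ℚₚ.toℚᵘ-cancel-≤ (begin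
  ℚ.toℚᵘ (fromℕ m)    ≃⟨ ℚₚ.toℚᵘ-fromℚᵘ (ℚᵘ.mkℚᵘ (+ m) 0) ⟩
  ℚᵘ.mkℚᵘ (+ m) 0     ≤⟨ ℚᵘ.*≤* (ℤₚ.*-monoʳ-≤-nonNeg (+ 1) (ℤ.+≤+ m≤k)) ⟩
  ℚᵘ.mkℚᵘ (+ k) 0     ≃⟨ ℚₚ.toℚᵘ-fromℚᵘ (ℚᵘ.mkℚᵘ (+ k) 0) ⟨
  ℚ.toℚᵘ (fromℕ k)    ∎)
  where open ℚᵘₚ.≤-Reasoning

-- Reciprocals and common denominators.

fromℕ*inv : ∀ m .{{_ : Nat.NonZero m}} → fromℕ m ℚ.* inv m ≡ ℚ.1ℚ
fromℕ*inv (suc m) = trans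
  (sym (fromℚᵘ-homo-* (ℚᵘ.mkℚᵘ (+ suc m) 0) (ℚᵘ.mkℚᵘ (+ 1) m)))
  (ℚₚ.fromℚᵘ-cong {x = ℚᵘ.mkℚᵘ (+ suc m) 0 ℚᵘ.* ℚᵘ.mkℚᵘ (+ 1) m} {y = ℚᵘ.1ℚᵘ} (ℚᵘ.*≡* (begin
    + suc m ℤ.* + 1 ℤ.* + 1  ≡⟨ ℤₚ.*-identityʳ (+ suc m ℤ.* + 1) ⟩
    + suc m ℤ.* + 1          ≡⟨ ℤₚ.*-identityʳ (+ suc m) ⟩
    + suc m                  ≡⟨ cong (λ k → + suc k) (ℕₚ.+-identityʳ m) ⟨
    + suc (m + 0)            ≡⟨ ℤₚ.*-identityˡ (+ suc (m + 0)) ⟨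
    + 1 ℤ.* + suc (m + 0)    ∎)))
  where open ≡-Reasoning

inv-nonNeg : ∀ m → ℚ.NonNegative (inv m)
inv-nonNeg zero    = _
inv-nonNeg (suc m) = ℚₚ.normalize-nonNeg 1 (suc m)

c*w≡N⇒inv≡w/N : ∀ c w N .{{_ : Nat.NonZero N}} → c * w ≡ N → inv c ≡ fromℕ w ℚ.* inv N
-- The default value of `inv` at 0 cannot occur: it would force `N` to be 0.
c*w≡N⇒inv≡w/N zero      w (suc N) ()
c*w≡N⇒inv≡w/N c@(suc _) w N c*w≡N = begin
  inv c                                      ≡⟨ ℚₚ.*-identityʳ (inv c) ⟨
  inv c ℚ.* ℚ.1ℚ                             ≡⟨ cong (inv c ℚ.*_) (fromℕ*inv N) ⟨
  inv c ℚ.* (fromℕ N ℚ.* inv N)              ≡⟨ cong (λ M → inv c ℚ.* (fromℕ M ℚ.* inv N)) c*w≡N ⟨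
  inv c ℚ.* (fromℕ (c * w) ℚ.* inv N)        ≡⟨ cong (λ q → inv c ℚ.* (q ℚ.* inv N)) (fromℕ-* c w) ⟩
  inv c ℚ.* (fromℕ c ℚ.* fromℕ w ℚ.* inv N)  ≡⟨ cong (inv c ℚ.*_) (ℚₚ.*-assoc (fromℕ c) (fromℕ w) (inv N)) ⟩
  inv c ℚ.* (fromℕ c ℚ.* (fromℕ w ℚ.* inv N)) ≡⟨ ℚₚ.*-assoc (inv c) (fromℕ c) _ ⟨
  inv c ℚ.* fromℕ c ℚ.* (fromℕ w ℚ.* inv N)  ≡⟨ cong (ℚ._* (fromℕ w ℚ.* inv N)) (trans (ℚₚ.*-comm (inv c) (fromℕ c)) (fromℕ*inv c)) ⟩
  ℚ.1ℚ ℚ.* (fromℕ w ℚ.* inv N)               ≡⟨ ℚₚ.*-identityˡ _ ⟩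
  fromℕ w ℚ.* inv N                          ∎
  where open ≡-Reasoning

-- By `nC∣P∣*weight` the denominator n! serves sets of every size, which carries the norm over to
-- the integer count.
norm≡listWeight/n! : (𝓕 : List (Subset n)) → ‖ 𝓕 ‖ ≡ fromℕ (listWeight 𝓕) ℚ.* inv (n !)
norm≡listWeight/n! {n} []ˡ       = sym (ℚₚ.*-zeroˡ (inv (n !)))
norm≡listWeight/n! {n} (F ∷ˡ 𝓕) = begin
  inv (n C ∣ F ∣) ℚ.+ ‖ 𝓕 ‖
    ≡⟨ cong₂ ℚ._+_ (c*w≡N⇒inv≡w/N (n C ∣ F ∣) (weight F) (n !) (nC∣P∣*weight F)) (norm≡listWeight/n! 𝓕) ⟩
  fromℕ (weight F) ℚ.* inv (n !) ℚ.+ fromℕ (listWeight 𝓕) ℚ.* inv (n !)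
    ≡⟨ ℚₚ.*-distribʳ-+ (inv (n !)) (fromℕ (weight F)) _ ⟨
  (fromℕ (weight F) ℚ.+ fromℕ (listWeight 𝓕)) ℚ.* inv (n !)
    ≡⟨ cong (ℚ._* inv (n !)) (fromℕ-+ (weight F) (listWeight 𝓕)) ⟨
  fromℕ (listWeight (F ∷ˡ 𝓕)) ℚ.* inv (n !) ∎
  where
  open ≡-Reasoning
  instance _ = n ℕₚ.!≢0

ΣFin-fromℕ* : ∀ s {f : Fin s → ℚ} {w : Fin s → ℕ} q →
  (∀ i → f i ≡ fromℕ (w i) ℚ.* q) → ΣFin s f ≡ fromℕ (sum w) ℚ.* q
ΣFin-fromℕ* zero            q f≡ = sym (ℚₚ.*-zeroˡ q)
ΣFin-fromℕ* (suc s) {f} {w} q f≡ = begin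
  f fzero ℚ.+ ΣFin s (f ∘ fsuc)
    ≡⟨ cong₂ ℚ._+_ (f≡ fzero) (ΣFin-fromℕ* s q (f≡ ∘ fsuc)) ⟩
  fromℕ (w fzero) ℚ.* q ℚ.+ fromℕ (sum (w ∘ fsuc)) ℚ.* q
    ≡⟨ ℚₚ.*-distribʳ-+ q (fromℕ (w fzero)) _ ⟨
  (fromℕ (w fzero) ℚ.+ fromℕ (sum (w ∘ fsuc))) ℚ.* q
    ≡⟨ cong (ℚ._* q) (fromℕ-+ (w fzero) (sum (w ∘ fsuc))) ⟨
  fromℕ (sum w) ℚ.* q ∎
  where open ≡-Reasoning

fromℕ[1+n]!*inv : ∀ n → fromℕ (suc n !) ℚ.* (inv (n !) ℚ.* inv (suc n)) ≡ ℚ.1ℚ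
fromℕ[1+n]!*inv n = begin
  fromℕ (suc n !) ℚ.* (inv (n !) ℚ.* inv (suc n))
    ≡⟨ cong (ℚ._* (inv (n !) ℚ.* inv (suc n))) (trans (fromℕ-* (suc n) (n !)) (ℚₚ.*-comm (fromℕ (suc n)) _)) ⟩
  fromℕ (n !) ℚ.* fromℕ (suc n) ℚ.* (inv (n !) ℚ.* inv (suc n))
    ≡⟨ *-interchange (fromℕ (n !)) _ _ _ ⟩
  fromℕ (n !) ℚ.* inv (n !) ℚ.* (fromℕ (suc n) ℚ.* inv (suc n))
    ≡⟨ cong₂ ℚ._*_ (fromℕ*inv (n !)) (fromℕ*inv (suc n)) ⟩
  ℚ.1ℚ ∎
  where
  open ≡-Reasoning
  instance _ = n ℕₚ.!≢0

theorem1p6 : (n s : ℕ) → (𝓕 : Fin (suc s) → List (Subset n)) →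
    ((i : Fin (suc s)) → Unique (𝓕 i)) →
    CrossDependent 𝓕 →
    ΣFin (suc s) (λ i → ϱ (𝓕 i)) ≤ (+ s) / 1
theorem1p6 n s 𝓕 𝓕! cross = begin
  ΣFin (suc s) (λ i → ϱ (𝓕 i))         ≡⟨ ΣFin-fromℕ* (suc s) {w = listWeight ∘ 𝓕} q ϱ≡ ⟩
  fromℕ (sum (listWeight ∘ 𝓕)) ℚ.* q   ≤⟨ ℚₚ.*-monoʳ-≤-nonNeg q (fromℕ-mono-≤ (sum-listWeight≤ 𝓕 𝓕! cross)) ⟩
  fromℕ (s * suc n !) ℚ.* q            ≡⟨ cong (ℚ._* q) (fromℕ-* s (suc n !)) ⟩
  fromℕ s ℚ.* fromℕ (suc n !) ℚ.* q    ≡⟨ ℚₚ.*-assoc (fromℕ s) (fromℕ (suc n !)) q ⟩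
  fromℕ s ℚ.* (fromℕ (suc n !) ℚ.* q)  ≡⟨ cong (fromℕ s ℚ.*_) (fromℕ[1+n]!*inv n) ⟩
  fromℕ s ℚ.* ℚ.1ℚ                     ≡⟨ ℚₚ.*-identityʳ (fromℕ s) ⟩
  fromℕ s                              ∎
  where
  open ℚₚ.≤-Reasoning
  -- This is 1/(n + 1)!, kept as a product because n! comes from the norm and n + 1 from `ϱ`.
  q = inv (n !) ℚ.* inv (suc n)
  instance
    _ : ℚ.NonNegative q
    _ = ℚₚ.nonNeg*nonNeg⇒nonNeg (inv (n !)) {{inv-nonNeg (n !)}} (inv (suc n)) {{inv-nonNeg (suc n)}}
  ϱ≡ : ∀ i → ϱ (𝓕 i) ≡ fromℕ (listWeight (𝓕 i)) ℚ.* q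
  ϱ≡ i = trans (cong (ℚ._* inv (suc n)) (norm≡listWeight/n! (𝓕 i)))
    (ℚₚ.*-assoc (fromℕ (listWeight (𝓕 i))) (inv (n !)) (inv (suc n)))
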